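{- For all nonnegative integers $m,n$ with $n\ge m\ge 0$, $$\binom{n}{m}=\sum_{l=0}^{n-m}\frac{\binom{l+m}{l}}{\binom{l+n+1}{l}}\,S_2(l+n+1,n+1)\,S_1(n,l+m).$$
   Context: $S_1(n,l)$ denotes the (signed) Stirling numbers of the first kind, defined by $(x)_n=\sum_{l=0}^{n}S_1(n,l)x^l$, where $(x)_n=x(x-1)\cdots(x-n+1)$ is the falling factorial, $(x)_0=1$. $S_2(n,k)$ denotes the Stirling numbers of the second kind, i.e. $(e^t-1)^k=k!\sum_{n\ge k}S_2(n,k)\frac{t^n}{n!}$. -}

module Defs where

open import Algebra.Bundles using (CommutativeRing)
open import Data.Fin.Base using (toℕ)
open import Data.Integer.Base using (+_)
open import Data.Nat.Base as ℕ using (ℕ; zero; suc; _!; _∸_; _≤_; NonZero; >-nonZero)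
open import Data.Nat.Combinatorics using (_C_; nCk≡n!/k![n-k]!; k![n∸k]!∣n!)
open import Data.Nat.Divisibility using (∣⇒≤)
open import Data.Nat.DivMod using (m≥n⇒m/n>0)
open import Data.Nat.Properties using (_!≢0; _!*_!≢0; ≤-trans; m≤m+n)
open import Data.Rational.Base using (ℚ; 0ℚ; 1ℚ; _/_; _-_; _*_)
open import Data.Rational.Properties using (+-*-commutativeRing)
open import Relation.Binary.PropositionalEquality using (subst; sym)

open import Algebra.Properties.Semiring.Sum (CommutativeRing.semiring +-*-commutativeRing) public
  using (sum; sum-syntax; sum⁺-syntax)

fromℕ : ℕ → ℚ
fromℕ n = + n / 1

-- Formal power series over ℚ in one variable, given by their coefficients.
-- Polynomials are treated as power series with finitely many nonzero terms.
Series : Set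
Series = ℕ → ℚ

const : ℚ → Series
const c zero    = c
const c (suc _) = 0ℚ

X : Series
X 1 = 1ℚ
X _ = 0ℚ

infixl 6 _⊖_
infixl 7 _⊛_
infixr 8 _^ˢ_

_⊖_ : Series → Series → Series
(f ⊖ g) n = f n - g n

_⊛_ : Series → Series → Series
(f ⊛ g) n = ∑[ i ≤ n ] (f (toℕ i) * g (n ∸ toℕ i))

_^ˢ_ : Series → ℕ → Series
f ^ˢ zero  = const 1ℚ
f ^ˢ suc k = f ⊛ (f ^ˢ k)

exp : Series
exp n = (+ 1 / n !) {{n !≢0}}

-- x (x - 1) ⋯ (x - n + 1)
falling : ℕ → Series
falling zero    = const 1ℚ
falling (suc n) = falling n ⊛ (X ⊖ const (fromℕ n))

-- The coefficient of xˡ in the falling factorial (x)ₙ.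
S₁ : ℕ → ℕ → ℚ
S₁ n l = falling n l

-- (eᵗ - 1)ᵏ = k! Σₙ S₂(n,k) tⁿ / n!, solved for S₂(n,k).
S₂ : ℕ → ℕ → ℚ
S₂ n k = (+ (n !) / k !) {{k !≢0}} * ((exp ⊖ const 1ℚ) ^ˢ k) n

nCk≢0 : ∀ {n k} → k ≤ n → NonZero (n C k)
nCk≢0 {n} {k} k≤n = subst NonZero (sym (nCk≡n!/k![n-k]! k≤n))
  (>-nonZero (m≥n⇒m/n>0 {{k !* (n ∸ k) !≢0}} (∣⇒≤ {{n !≢0}} (k![n∸k]!∣n! k≤n))))

l≤l+n+1 : ∀ l n → l ≤ l ℕ.+ n ℕ.+ 1
l≤l+n+1 l n = ≤-trans (m≤m+n l n) (m≤m+n (l ℕ.+ n) 1)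

{-# OPTIONS --safe #-}
module Submission where

-- Put E = (eᵗ - 1) / t. Up to the factor 1 / m! the right-hand side is ⟨(x)ₙ | tᵐ Eⁿ⁺¹⟩, where
-- ⟨xʲ | tᵏ⟩ = j! if j = k and 0 otherwise. The transfer formula for the forward difference,
-- ⟨(x)ₙ | g Eⁿ⁺¹⟩ = n! [tⁿ] eᵗ g for every series g, then gives n! / (n - m)! for g = tᵐ. It follows
-- by induction on n from (x)ₙ₊₁ = (x)ₙ (x - n), because multiplication by x is adjoint to d/dt.

open import Defs
open import Algebra.Bundles using (CommutativeRing; CommutativeSemiring)
import Algebra.Properties.Group as Group
open import Algebra.Structures.Biased using (IsCommutativeSemiringˡ)
import Algebra.Solver.Ring.NaturalCoefficients.Default as SemiringSolver
open import Data.Fin.Base using (toℕ)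
open import Data.Integer.Base as ℤ using (+_)
import Data.Integer.Properties as ℤ
open import Data.Nat.Base as ℕ using (ℕ; zero; suc; _!; _+_; _∸_; _≤_; _<_; z≤n; s≤s; NonZero)
open import Data.Nat.Combinatorics using (_C_; nCk≡n!/k![n-k]!; k![n∸k]!∣n!)
open import Data.Nat.DivMod using (m/n*n≡m)
import Data.Nat.Properties as ℕ
open import Data.Nat.Properties using (_!≢0; _!*_!≢0)
import Data.Nat.Solver as ℕ
open import Data.Product.Base using (_,_)
open import Data.Rational.Base using (ℚ; 0ℚ; 1ℚ; _/_; _*_; _-_; toℚᵘ)
  renaming (_+_ to infixl 6 _⊕_)
import Data.Rational.Properties as ℚ
open import Data.Rational.Properties using (+-*-commutativeRing)
open import Data.Rational.Solver using (module +-*-Solver)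
open import Data.Rational.Unnormalised.Base as ℚᵘ using (mkℚᵘ; *≡*)
import Data.Rational.Unnormalised.Properties as ℚᵘ
open import Level using (0ℓ)
open import Relation.Binary.PropositionalEquality
import Relation.Binary.Reasoning.Setoid as SetoidReasoning
open import Relation.Binary.Structures using (IsEquivalence)
open import Algebra.Properties.Semiring.Sum (CommutativeRing.semiring +-*-commutativeRing)
  using (sum-cong-≗; *-distribˡ-sum; ∑-distrib-+)

-- The commutative semiring of formal power series.

infixl 6 _⊞_

_⊞_ : Series → Series → Series
(f ⊞ g) n = f n ⊕ g n

0ˢ : Series
0ˢ _ = 0ℚ

-- Drops the constant term and divides by t. By computation `(f ⊛ g) (suc n)` is
-- `f 0 * g (suc n) ⊕ (shift f ⊛ g) n`, so inductions on a coefficient of a product pass from `f` to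
-- `shift f`.
shift : Series → Series
shift f n = f (suc n)

⊛-cong : ∀ {f f′ g g′} → f ≗ f′ → g ≗ g′ → f ⊛ g ≗ f′ ⊛ g′
⊛-cong p q n = sum-cong-≗ {suc n} λ i → cong₂ _*_ (p (toℕ i)) (q (n ∸ toℕ i))

⊛-congˡ : ∀ f {g g′} → g ≗ g′ → f ⊛ g ≗ f ⊛ g′
⊛-congˡ f {g} {g′} = ⊛-cong {f} {f} {g} {g′} (λ _ → refl)

⊛-congʳ : ∀ {f f′} g → f ≗ f′ → f ⊛ g ≗ f′ ⊛ g
⊛-congʳ {f} {f′} g p = ⊛-cong {f} {f′} {g} {g} p (λ _ → refl)

0ˢ-⊛ : ∀ f → 0ˢ ⊛ f ≗ 0ˢ
0ˢ-⊛ f zero = trans (ℚ.+-identityʳ _) (ℚ.*-zeroˡ (f 0))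
0ˢ-⊛ f (suc n) = cong₂ _⊕_ (ℚ.*-zeroˡ (f (suc n))) (0ˢ-⊛ f n)

scale-⊛ : ∀ c f g → (λ n → c * f n) ⊛ g ≗ λ n → c * (f ⊛ g) n
scale-⊛ c f g n = trans (sum-cong-≗ {suc n} λ i → ℚ.*-assoc c (f (toℕ i)) (g (n ∸ toℕ i)))
  (sym (*-distribˡ-sum {suc n} c (λ i → f (toℕ i) * g (n ∸ toℕ i))))

const-⊛ : ∀ c f → const c ⊛ f ≗ λ n → c * f n
const-⊛ c f zero = ℚ.+-identityʳ _
const-⊛ c f (suc n) = trans (cong (c * f (suc n) ⊕_) (0ˢ-⊛ f n)) (ℚ.+-identityʳ _)

⊛-distribʳ-⊞ : ∀ h f g → (f ⊞ g) ⊛ h ≗ (f ⊛ h) ⊞ (g ⊛ h)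
⊛-distribʳ-⊞ h f g n = trans
  (sum-cong-≗ {suc n} λ i → ℚ.*-distribʳ-+ (h (n ∸ toℕ i)) (f (toℕ i)) (g (toℕ i)))
  (∑-distrib-+ {suc n} (λ i → f (toℕ i) * h (n ∸ toℕ i)) (λ i → g (toℕ i) * h (n ∸ toℕ i)))

-- Convolution computes by splitting off the term with `f 0`; this mirror image splits off the term
-- with `g 0`, which gives commutativity and later the Leibniz rule.
⊛-unfoldʳ : ∀ f g n → (f ⊛ g) (suc n) ≡ f (suc n) * g 0 ⊕ (f ⊛ shift g) n
⊛-unfoldʳ f g zero = solve 4 (λ a b c d → a :* b :+ (c :* d :+ con 0ℚ) := c :* d :+ (a :* b :+ con 0ℚ))
  refl (f 0) (g 1) (f 1) (g 0)
  where open +-*-Solver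
⊛-unfoldʳ f g (suc n) = trans (cong (f 0 * g (suc (suc n)) ⊕_) (⊛-unfoldʳ (shift f) g n))
  (solve 3 (λ a b c → a :+ (b :+ c) := b :+ (a :+ c)) refl
    (f 0 * g (suc (suc n))) (f (suc (suc n)) * g 0) ((shift f ⊛ shift g) n))
  where open +-*-Solver

⊛-comm : ∀ f g → f ⊛ g ≗ g ⊛ f
⊛-comm f g zero = cong (_⊕ 0ℚ) (ℚ.*-comm (f 0) (g 0))
⊛-comm f g (suc n) = trans
  (cong₂ _⊕_ (ℚ.*-comm (f 0) (g (suc n))) (⊛-comm (shift f) g n))
  (sym (⊛-unfoldʳ g f n))

⊛-assoc : ∀ f g h → (f ⊛ g) ⊛ h ≗ f ⊛ (g ⊛ h)
⊛-assoc f g h zero = solve 3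
  (λ a b c → (a :* b :+ con 0ℚ) :* c :+ con 0ℚ := a :* (b :* c :+ con 0ℚ) :+ con 0ℚ)
  refl (f 0) (g 0) (h 0)
  where open +-*-Solver
⊛-assoc f g h (suc n) = begin
  -- The shift of `f ⊛ g` is itself a sum of two series, f₀ times `shift g` and `shift f ⊛ g`;
  -- distributivity separates them and induction applies to the second.
  (f 0 * g 0 ⊕ 0ℚ) * h (suc n) ⊕ (((λ k → f 0 * g (suc k)) ⊞ (shift f ⊛ g)) ⊛ h) n
    ≡⟨ cong ((f 0 * g 0 ⊕ 0ℚ) * h (suc n) ⊕_) (trans (⊛-distribʳ-⊞ h (λ k → f 0 * g (suc k)) (shift f ⊛ g) n)
         (cong₂ _⊕_ (scale-⊛ (f 0) (shift g) h n) (⊛-assoc (shift f) g h n))) ⟩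
  (f 0 * g 0 ⊕ 0ℚ) * h (suc n) ⊕ (f 0 * (shift g ⊛ h) n ⊕ (shift f ⊛ (g ⊛ h)) n)
    ≡⟨ solve 5 (λ a b c d e → (a :* b :+ con 0ℚ) :* c :+ (a :* d :+ e) := a :* (b :* c :+ d) :+ e)
         refl (f 0) (g 0) (h (suc n)) ((shift g ⊛ h) n) ((shift f ⊛ (g ⊛ h)) n) ⟩
  f 0 * (g 0 * h (suc n) ⊕ (shift g ⊛ h) n) ⊕ (shift f ⊛ (g ⊛ h)) n ∎
  where
  open ≡-Reasoning
  open +-*-Solver

⊛-identityˡ : ∀ f → const 1ℚ ⊛ f ≗ f
⊛-identityˡ f n = trans (const-⊛ 1ℚ f n) (ℚ.*-identityˡ (f n))

seriesSemiring : CommutativeSemiring 0ℓ 0ℓ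
seriesSemiring = record
  { Carrier = Series
  ; _≈_ = _≗_
  ; _+_ = _⊞_
  ; _*_ = _⊛_
  ; 0# = 0ˢ
  ; 1# = const 1ℚ
  ; isCommutativeSemiring = IsCommutativeSemiringˡ.isCommutativeSemiring record
    { +-isCommutativeMonoid = record
      { isMonoid = record
        { isSemigroup = record
          { isMagma = record
            { isEquivalence = ≗-isEquivalence
            ; ∙-cong = λ p q n → cong₂ _⊕_ (p n) (q n)
            }
          ; assoc = λ f g h n → ℚ.+-assoc (f n) (g n) (h n)
          }
        ; identity = (λ f n → ℚ.+-identityˡ (f n)) , (λ f n → ℚ.+-identityʳ (f n))
        }
      ; comm = λ f g n → ℚ.+-comm (f n) (g n)
      }
    ; *-isCommutativeMonoid = record
      { isMonoid = record
        { isSemigroup = record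
          { isMagma = record
            { isEquivalence = ≗-isEquivalence
            ; ∙-cong = ⊛-cong
            }
          ; assoc = ⊛-assoc
          }
        ; identity = ⊛-identityˡ , (λ f n → trans (⊛-comm f (const 1ℚ) n) (⊛-identityˡ f n))
        }
      ; comm = ⊛-comm
      }
    ; distribʳ = ⊛-distribʳ-⊞
    ; zeroˡ = 0ˢ-⊛
    }
  }
  where
  ≗-isEquivalence : IsEquivalence {A = Series} _≗_
  ≗-isEquivalence = record
    { refl = λ _ → refl ; sym = λ p n → sym (p n) ; trans = λ p q n → trans (p n) (q n) }

open CommutativeSemiring seriesSemiring using ()
  renaming (setoid to seriesSetoid; +-cong to ⊞-cong; zeroʳ to ⊛-zeroʳ)

-- Fractions, factorials and binomial coefficients.

-- Cross-multiplication turns identities between fractions of factorials into identities in ℕ. The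
-- detour through unnormalised rationals avoids the gcd that `_/_` divides out.
/-*-/ : ∀ a b c d e f .{{_ : NonZero b}} .{{_ : NonZero d}} .{{_ : NonZero f}} →
  a ℕ.* c ℕ.* f ≡ e ℕ.* (b ℕ.* d) → (+ a / b) * (+ c / d) ≡ + e / f
/-*-/ a b@(suc b-1) c d@(suc d-1) e f@(suc f-1) eq = ℚ.toℚᵘ-injective (begin
  toℚᵘ ((+ a / b) * (+ c / d))
    ≈⟨ ℚ.toℚᵘ-homo-* (+ a / b) (+ c / d) ⟩
  toℚᵘ (+ a / b) ℚᵘ.* toℚᵘ (+ c / d)
    ≈⟨ ℚᵘ.*-cong (ℚ.toℚᵘ-fromℚᵘ (mkℚᵘ (+ a) b-1)) (ℚ.toℚᵘ-fromℚᵘ (mkℚᵘ (+ c) d-1)) ⟩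
  mkℚᵘ (+ a) b-1 ℚᵘ.* mkℚᵘ (+ c) d-1
    ≈⟨ *≡* (trans (cong (ℤ._* + f) (sym (ℤ.pos-* a c)))
         (trans (sym (ℤ.pos-* (a ℕ.* c) f)) (trans (cong +_ eq) (ℤ.pos-* e (b ℕ.* d))))) ⟩
  mkℚᵘ (+ e) f-1
    ≈⟨ ℚ.toℚᵘ-fromℚᵘ (mkℚᵘ (+ e) f-1) ⟨
  toℚᵘ (+ e / f) ∎)
  where open ℚᵘ.≃-Reasoning

fromℕ-* : ∀ a b → fromℕ (a ℕ.* b) ≡ fromℕ a * fromℕ b
fromℕ-* a b = sym (/-*-/ a 1 b 1 (a ℕ.* b) 1 refl)

fromℕ-suc : ∀ n → fromℕ (suc n) ≡ 1ℚ ⊕ fromℕ n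
fromℕ-suc n = ℚ.toℚᵘ-injective (begin
  toℚᵘ (fromℕ (suc n))
    ≈⟨ ℚ.toℚᵘ-fromℚᵘ (mkℚᵘ (+ suc n) 0) ⟩
  mkℚᵘ (+ suc n) 0
    ≈⟨ *≡* (cong (λ k → (+ 1 ℤ.+ k) ℤ.* + 1) (sym (ℤ.*-identityʳ (+ n)))) ⟩
  mkℚᵘ (+ 1) 0 ℚᵘ.+ mkℚᵘ (+ n) 0
    ≈⟨ ℚᵘ.+-cong (ℚᵘ.≃-refl {toℚᵘ 1ℚ}) (ℚ.toℚᵘ-fromℚᵘ (mkℚᵘ (+ n) 0)) ⟨
  toℚᵘ 1ℚ ℚᵘ.+ toℚᵘ (fromℕ n)
    ≈⟨ ℚ.toℚᵘ-homo-+ 1ℚ (fromℕ n) ⟨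
  toℚᵘ (1ℚ ⊕ fromℕ n) ∎)
  where open ℚᵘ.≃-Reasoning

nCk*k![n∸k]!≡n! : ∀ {n k} → k ≤ n → (n C k) ℕ.* (k ! ℕ.* (n ∸ k) !) ≡ n !
nCk*k![n∸k]!≡n! {n} {k} k≤n = trans (cong (ℕ._* (k ! ℕ.* (n ∸ k) !)) (nCk≡n!/k![n-k]! k≤n))
  (m/n*n≡m {{k !* (n ∸ k) !≢0}} (k![n∸k]!∣n! k≤n))

[l+k]Cl*l!k!≡[l+k]! : ∀ l k → ((l + k) C l) ℕ.* (l ! ℕ.* k !) ≡ (l + k) !
[l+k]Cl*l!k!≡[l+k]! l k = subst (λ j → ((l + k) C l) ℕ.* (l ! ℕ.* j !) ≡ (l + k) !)
  (ℕ.m+n∸m≡n l k) (nCk*k![n∸k]!≡n! (ℕ.m≤m+n l k))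

-- Sums whose outer terms vanish.

∑-zero-last : ∀ n (h : ℕ → ℚ) → h (suc n) ≡ 0ℚ → ∑[ i ≤ suc n ] h (toℕ i) ≡ ∑[ i ≤ n ] h (toℕ i)
∑-zero-last zero h eq = cong (λ x → h 0 ⊕ (x ⊕ 0ℚ)) eq
∑-zero-last (suc n) h eq = cong (h 0 ⊕_) (∑-zero-last n (shift h) eq)

∑-zero-init : ∀ {m n} → m ≤ n → (h : ℕ → ℚ) → (∀ {j} → j < m → h j ≡ 0ℚ) →
  ∑[ i ≤ n ] h (toℕ i) ≡ ∑[ i ≤ n ∸ m ] h (toℕ i + m)
∑-zero-init {n = n} z≤n h _ = sum-cong-≗ {suc n} λ i → cong h (sym (ℕ.+-identityʳ (toℕ i)))
∑-zero-init {suc m} {suc n} (s≤s m≤n) h h≡0 = begin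
  h 0 ⊕ ∑[ i ≤ n ] h (suc (toℕ i))
    ≡⟨ cong₂ _⊕_ (h≡0 (s≤s z≤n)) (∑-zero-init m≤n (shift h) λ j<m → h≡0 (s≤s j<m)) ⟩
  0ℚ ⊕ ∑[ i ≤ n ∸ m ] h (suc (toℕ i + m))
    ≡⟨ ℚ.+-identityˡ _ ⟩
  ∑[ i ≤ n ∸ m ] h (suc (toℕ i + m))
    ≡⟨ sum-cong-≗ {suc (n ∸ m)} (λ i → cong h (sym (ℕ.+-suc (toℕ i) m))) ⟩
  ∑[ i ≤ n ∸ m ] h (toℕ i + suc m) ∎
  where open ≡-Reasoning

-- Multiplication by powers of t.

X-⊛-suc : ∀ f n → (X ⊛ f) (suc n) ≡ f n
X-⊛-suc f n = begin
  0ℚ * f (suc n) ⊕ (shift X ⊛ f) n ≡⟨ cong₂ _⊕_ (ℚ.*-zeroˡ (f (suc n))) (⊛-congʳ f shift-X n) ⟩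
  0ℚ ⊕ (const 1ℚ ⊛ f) n           ≡⟨ ℚ.+-identityˡ _ ⟩
  (const 1ℚ ⊛ f) n                 ≡⟨ ⊛-identityˡ f n ⟩
  f n                              ∎
  where
  open ≡-Reasoning
  shift-X : shift X ≗ const 1ℚ
  shift-X zero = refl
  shift-X (suc _) = refl

X-⊛-zero : ∀ f → (X ⊛ f) 0 ≡ 0ℚ
X-⊛-zero f = trans (ℚ.+-identityʳ _) (ℚ.*-zeroˡ (f 0))

X^-⊛-+ : ∀ m f l → (X ^ˢ m ⊛ f) (l + m) ≡ f l
X^-⊛-+ zero f l = trans (⊛-identityˡ f (l + 0)) (cong f (ℕ.+-identityʳ l))
X^-⊛-+ (suc m) f l = begin
  (X ⊛ X ^ˢ m ⊛ f) (l + suc m)    ≡⟨ cong (X ⊛ X ^ˢ m ⊛ f) (ℕ.+-suc l m) ⟩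
  (X ⊛ X ^ˢ m ⊛ f) (suc (l + m))  ≡⟨ ⊛-assoc X (X ^ˢ m) f (suc (l + m)) ⟩
  (X ⊛ (X ^ˢ m ⊛ f)) (suc (l + m)) ≡⟨ X-⊛-suc (X ^ˢ m ⊛ f) (l + m) ⟩
  (X ^ˢ m ⊛ f) (l + m)            ≡⟨ X^-⊛-+ m f l ⟩
  f l                             ∎
  where open ≡-Reasoning

X^-⊛-< : ∀ {m} f {j} → j < m → (X ^ˢ m ⊛ f) j ≡ 0ℚ
X^-⊛-< {suc m} f {zero} _ = trans (⊛-assoc X (X ^ˢ m) f 0) (X-⊛-zero (X ^ˢ m ⊛ f))
X^-⊛-< {suc m} f {suc j} (s≤s j<m) = trans (⊛-assoc X (X ^ˢ m) f (suc j))
  (trans (X-⊛-suc (X ^ˢ m ⊛ f) j) (X^-⊛-< f j<m))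

-- Differentiation of power series.

-- `θ` is t d/dt and `∂` is d/dt, so `∂ f` is `shift (θ f)` by computation. The operator `θ` keeps
-- every index in place, which makes its product rule the easier one to prove first.
θ ∂ : Series → Series
θ f n = fromℕ n * f n
∂ f n = fromℕ (suc n) * f (suc n)

-- The weight n of the term fᵢ gₙ₋ᵢ splits as i + (n - i). In the induction the extra 1 in `suc n`
-- is credited to the first factor, through `shift-θ`.
θ-⊛ : ∀ f g n → θ (f ⊛ g) n ≡ (θ f ⊛ g) n ⊕ (f ⊛ θ g) n
θ-⊛ f g zero = solve 2
  (λ a b → con 0ℚ :* (a :* b :+ con 0ℚ) := (con 0ℚ :* a :* b :+ con 0ℚ) :+ (a :* (con 0ℚ :* b) :+ con 0ℚ))
  refl (f 0) (g 0)
  where open +-*-Solver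
θ-⊛ f g (suc n) = begin
  fromℕ (suc n) * (f 0 * g (suc n) ⊕ p)
    ≡⟨ cong (_* (f 0 * g (suc n) ⊕ p)) (fromℕ-suc n) ⟩
  (1ℚ ⊕ fromℕ n) * (f 0 * g (suc n) ⊕ p)
    ≡⟨ solve 4 (λ c a b p → (con 1ℚ :+ c) :* (a :* b :+ p) := (con 1ℚ :+ c) :* (a :* b) :+ (p :+ c :* p))
         refl (fromℕ n) (f 0) (g (suc n)) p ⟩
  (1ℚ ⊕ fromℕ n) * (f 0 * g (suc n)) ⊕ (p ⊕ fromℕ n * p)
    ≡⟨ cong₂ (λ c x → c * (f 0 * g (suc n)) ⊕ (p ⊕ x)) (sym (fromℕ-suc n)) (θ-⊛ (shift f) g n) ⟩
  fromℕ (suc n) * (f 0 * g (suc n)) ⊕ (p ⊕ (q ⊕ r))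
    ≡⟨ solve 6 (λ c a b p q r → c :* (a :* b) :+ (p :+ (q :+ r)) :=
           ((con 0ℚ :* a) :* b :+ (p :+ q)) :+ (a :* (c :* b) :+ r))
         refl (fromℕ (suc n)) (f 0) (g (suc n)) p q r ⟩
  (0ℚ * f 0 * g (suc n) ⊕ (p ⊕ q)) ⊕ (f 0 * (fromℕ (suc n) * g (suc n)) ⊕ r)
    ≡⟨ cong (λ x → (0ℚ * f 0 * g (suc n) ⊕ x) ⊕ (f 0 * (fromℕ (suc n) * g (suc n)) ⊕ r))
         (trans (sym (⊛-distribʳ-⊞ g (shift f) (θ (shift f)) n)) (⊛-congʳ g shift-θ n)) ⟩
  (0ℚ * f 0 * g (suc n) ⊕ (shift (θ f) ⊛ g) n) ⊕ (f 0 * (fromℕ (suc n) * g (suc n)) ⊕ r) ∎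
  where
  open ≡-Reasoning
  open +-*-Solver
  p = (shift f ⊛ g) n
  q = (θ (shift f) ⊛ g) n
  r = (shift f ⊛ θ g) n
  shift-θ : shift f ⊞ θ (shift f) ≗ shift (θ f)
  shift-θ k = trans
    (solve 2 (λ c x → x :+ c :* x := (con 1ℚ :+ c) :* x) refl (fromℕ k) (f (suc k)))
    (cong (_* f (suc k)) (sym (fromℕ-suc k)))

-- The product rule for `θ`, read at index `suc n`: the two boundary terms contain the constant
-- coefficients of `θ f` and `θ g`, which are 0, and the rest is already in terms of `∂`.
∂-⊛ : ∀ f g → ∂ (f ⊛ g) ≗ ∂ f ⊛ g ⊞ f ⊛ ∂ g
∂-⊛ f g n = begin
  θ (f ⊛ g) (suc n)
    ≡⟨ θ-⊛ f g (suc n) ⟩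
  (0ℚ * f 0 * g (suc n) ⊕ (∂ f ⊛ g) n) ⊕ (f ⊛ θ g) (suc n)
    ≡⟨ cong ((0ℚ * f 0 * g (suc n) ⊕ (∂ f ⊛ g) n) ⊕_) (⊛-unfoldʳ f (θ g) n) ⟩
  (0ℚ * f 0 * g (suc n) ⊕ (∂ f ⊛ g) n) ⊕ (f (suc n) * (0ℚ * g 0) ⊕ (f ⊛ ∂ g) n)
    ≡⟨ solve 6 (λ a b c d p q → (con 0ℚ :* a :* b :+ p) :+ (c :* (con 0ℚ :* d) :+ q) := p :+ q)
         refl (f 0) (g (suc n)) (f (suc n)) (g 0) ((∂ f ⊛ g) n) ((f ⊛ ∂ g) n) ⟩
  (∂ f ⊛ g) n ⊕ (f ⊛ ∂ g) n ∎
  where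
  open ≡-Reasoning
  open +-*-Solver

-- Over an abstract semiring the operations stay opaque to the solver, whereas those on series would
-- unfold to sums of coefficients.
module SemiringIdentities {c ℓ} (R : CommutativeSemiring c ℓ) where
  open CommutativeSemiring R using (Carrier; _≈_; 1#) renaming (_+_ to _⊹_; _*_ to _·_; refl to ≈-refl)
  open SemiringSolver R

  product-of-products : ∀ x f y g → (x · f) · (y · g) ≈ (x · y) · (f · g)
  product-of-products = solve 4 (λ x f y g → (x :* f) :* (y :* g) := (x :* y) :* (f :* g)) ≈-refl

  power-step : ∀ f f′ p c → f′ · (f · p) ⊹ f · (c · (f′ · p)) ≈ (1# ⊹ c) · (f′ · (f · p))
  power-step = solve 4
    (λ f f′ p c → f′ :* (f :* p) :+ f :* (c :* (f′ :* p)) := (con 1 :+ c) :* (f′ :* (f :* p))) ≈-refl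

  regroup : ∀ g g′ E E′ P c → g′ · (E · P) ⊹ g · (c · (E′ · P)) ≈ (g′ · E ⊹ c · (g · E′)) · P
  regroup = solve 6 (λ g g′ E E′ P c →
    g′ :* (E :* P) :+ g :* (c :* (E′ :* P)) := (g′ :* E :+ c :* (g :* E′)) :* P) ≈-refl

  derivative-step : ∀ e g g′ E E′ c →
    e · (g′ · E ⊹ (1# ⊹ c) · (g · E′)) ⊹ e · (g · E) ≈
    (e · (g · E) ⊹ e · (g′ · E ⊹ g · E′)) ⊹ c · (e · (g · E′))
  derivative-step = solve 6 (λ e g g′ E E′ c →
    e :* (g′ :* E :+ (con 1 :+ c) :* (g :* E′)) :+ e :* (g :* E) :=
    (e :* (g :* E) :+ e :* (g′ :* E :+ g :* E′)) :+ c :* (e :* (g :* E′))) ≈-refl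

  factor-left : ∀ e g E x E′ → e · (g · E) ⊹ x · (e · (g · E′)) ≈ (e · g) · (E ⊹ x · E′)
  factor-left = solve 5 (λ e g E x E′ →
    e :* (g :* E) :+ x :* (e :* (g :* E′)) := (e :* g) :* (E :+ x :* E′)) ≈-refl

  expand-right : ∀ e g x E → (e · g) · (1# ⊹ x · E) ≈ e · g ⊹ x · (e · (g · E))
  expand-right = solve 4 (λ e g x E → (e :* g) :* (con 1 :+ x :* E) := e :* g :+ x :* (e :* (g :* E))) ≈-refl

open SemiringIdentities seriesSemiring

-- Powers of series and their derivatives.

⊞-congˡ : ∀ f {g g′} → g ≗ g′ → f ⊞ g ≗ f ⊞ g′
⊞-congˡ f p n = cong (f n ⊕_) (p n)

⊞-congʳ : ∀ {f f′} g → f ≗ f′ → f ⊞ g ≗ f′ ⊞ g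
⊞-congʳ g p n = cong (_⊕ g n) (p n)

∂-const : ∀ c → ∂ (const c) ≗ 0ˢ
∂-const c n = ℚ.*-zeroʳ (fromℕ (suc n))

const-suc : ∀ n → const (fromℕ (suc n)) ≗ const 1ℚ ⊞ const (fromℕ n)
const-suc n zero = fromℕ-suc n
const-suc n (suc _) = refl

∂-^ : ∀ f k → ∂ (f ^ˢ suc k) ≗ const (fromℕ (suc k)) ⊛ (∂ f ⊛ f ^ˢ k)
∂-^ f zero = begin
  ∂ (f ⊛ const 1ℚ)                              ≈⟨ ∂-⊛ f (const 1ℚ) ⟩
  ∂ f ⊛ const 1ℚ ⊞ f ⊛ ∂ (const 1ℚ)             ≈⟨ ⊞-congˡ (∂ f ⊛ const 1ℚ) (⊛-congˡ f (∂-const 1ℚ)) ⟩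
  ∂ f ⊛ const 1ℚ ⊞ f ⊛ 0ˢ                       ≈⟨ ⊞-congˡ (∂ f ⊛ const 1ℚ) (⊛-zeroʳ f) ⟩
  ∂ f ⊛ const 1ℚ ⊞ 0ˢ                           ≈⟨ (λ n → ℚ.+-identityʳ _) ⟩
  ∂ f ⊛ const 1ℚ                                ≈⟨ ⊛-identityˡ (∂ f ⊛ const 1ℚ) ⟨
  const 1ℚ ⊛ (∂ f ⊛ const 1ℚ)                   ∎
  where open SetoidReasoning seriesSetoid
∂-^ f (suc k) = begin
  ∂ (f ⊛ f ^ˢ suc k)
    ≈⟨ ∂-⊛ f (f ^ˢ suc k) ⟩
  ∂ f ⊛ f ^ˢ suc k ⊞ f ⊛ ∂ (f ^ˢ suc k)
    ≈⟨ ⊞-congˡ (∂ f ⊛ f ^ˢ suc k) (⊛-congˡ f (∂-^ f k)) ⟩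
  ∂ f ⊛ (f ⊛ f ^ˢ k) ⊞ f ⊛ (const (fromℕ (suc k)) ⊛ (∂ f ⊛ f ^ˢ k))
    ≈⟨ power-step f (∂ f) (f ^ˢ k) (const (fromℕ (suc k))) ⟩
  (const 1ℚ ⊞ const (fromℕ (suc k))) ⊛ (∂ f ⊛ f ^ˢ suc k)
    ≈⟨ ⊛-congʳ (∂ f ⊛ f ^ˢ suc k) (const-suc (suc k)) ⟨
  const (fromℕ (suc (suc k))) ⊛ (∂ f ⊛ f ^ˢ suc k) ∎
  where open SetoidReasoning seriesSetoid

^-cong : ∀ {f g} k → f ≗ g → f ^ˢ k ≗ g ^ˢ k
^-cong zero p _ = refl
^-cong (suc k) p = ⊛-cong p (^-cong k p)

^-distrib-⊛ : ∀ f g k → (f ⊛ g) ^ˢ k ≗ f ^ˢ k ⊛ g ^ˢ k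
^-distrib-⊛ f g zero n = sym (⊛-identityˡ (const 1ℚ) n)
^-distrib-⊛ f g (suc k) = begin
  (f ⊛ g) ⊛ (f ⊛ g) ^ˢ k       ≈⟨ ⊛-congˡ (f ⊛ g) (^-distrib-⊛ f g k) ⟩
  (f ⊛ g) ⊛ (f ^ˢ k ⊛ g ^ˢ k)  ≈⟨ product-of-products f g (f ^ˢ k) (g ^ˢ k) ⟩
  (f ⊛ f ^ˢ k) ⊛ (g ⊛ g ^ˢ k)  ∎
  where open SetoidReasoning seriesSetoid

-- The series eᵗ and E.

-- (eᵗ - 1) / t
E : Series
E = shift exp

exp⊖1≗X⊛E : exp ⊖ const 1ℚ ≗ X ⊛ E
exp⊖1≗X⊛E zero = sym (X-⊛-zero E)
exp⊖1≗X⊛E (suc n) = trans (ℚ.+-identityʳ (E n)) (sym (X-⊛-suc E n))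

1⊞X⊛E≗exp : const 1ℚ ⊞ X ⊛ E ≗ exp
1⊞X⊛E≗exp zero = cong (1ℚ ⊕_) (X-⊛-zero E)
1⊞X⊛E≗exp (suc n) = trans (ℚ.+-identityˡ ((X ⊛ E) (suc n))) (X-⊛-suc E n)

∂-exp : ∂ exp ≗ exp
∂-exp n = /-*-/ (suc n) 1 1 (suc n !) 1 (n !) {{_}} {{suc n !≢0}} {{n !≢0}}
  (solve 2 (λ s f → s :* con 1 :* f := con 1 :* (con 1 :* (s :* f))) refl (suc n) (n !))
  where open ℕ.+-*-Solver

-- The left-hand side is (t E)′, and t E = eᵗ - 1.
E⊞X⊛∂E≗exp : E ⊞ X ⊛ ∂ E ≗ exp
E⊞X⊛∂E≗exp zero = cong (1ℚ ⊕_) (X-⊛-zero (∂ E))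
E⊞X⊛∂E≗exp (suc n) = begin
  E (suc n) ⊕ (X ⊛ ∂ E) (suc n)              ≡⟨ cong (E (suc n) ⊕_) (X-⊛-suc (∂ E) n) ⟩
  E (suc n) ⊕ fromℕ (suc n) * E (suc n)      ≡⟨ solve 2 (λ c x → x :+ c :* x := (con 1ℚ :+ c) :* x) refl
                                                  (fromℕ (suc n)) (E (suc n)) ⟩
  (1ℚ ⊕ fromℕ (suc n)) * E (suc n)           ≡⟨ cong (_* E (suc n)) (fromℕ-suc (suc n)) ⟨
  ∂ exp (suc n)                              ≡⟨ ∂-exp (suc n) ⟩
  exp (suc n)                                ∎
  where
  open ≡-Reasoning
  open +-*-Solver

-- Coefficients of the falling factorials.

falling-suc-⊛ : ∀ n → falling (suc n) ≗ (X ⊖ const (fromℕ n)) ⊛ falling n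
falling-suc-⊛ n = ⊛-comm (falling n) (X ⊖ const (fromℕ n))

-- Moving n (x)ₙ to the left turns (x)ₙ₊₁ = (x)ₙ (x - n) into a rule for x (x)ₙ free of subtraction.
-- The constant coefficient is treated here, the others in `falling-suc-suc`.
falling-suc-zero : ∀ n → falling (suc n) 0 ⊕ fromℕ n * falling n 0 ≡ 0ℚ
falling-suc-zero n = trans (cong (_⊕ fromℕ n * falling n 0) (falling-suc-⊛ n 0))
  (solve 2 (λ c x → ((con 0ℚ :- c) :* x :+ con 0ℚ) :+ c :* x := con 0ℚ) refl (fromℕ n) (falling n 0))
  where open +-*-Solver

falling-suc-suc : ∀ n j → falling (suc n) (suc j) ⊕ fromℕ n * falling n (suc j) ≡ falling n j
falling-suc-suc n j = begin
  falling (suc n) (suc j) ⊕ c * falling n (suc j)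
    ≡⟨ cong (_⊕ c * falling n (suc j)) (falling-suc-⊛ n (suc j)) ⟩
  ((0ℚ - c) * falling n (suc j) ⊕ (shift (X ⊖ const c) ⊛ falling n) j) ⊕ c * falling n (suc j)
    ≡⟨ cong (λ x → ((0ℚ - c) * falling n (suc j) ⊕ x) ⊕ c * falling n (suc j))
         (trans (⊛-congʳ (falling n) shift-X⊖c j) (⊛-identityˡ (falling n) j)) ⟩
  ((0ℚ - c) * falling n (suc j) ⊕ falling n j) ⊕ c * falling n (suc j)
    ≡⟨ solve 3 (λ c x y → ((con 0ℚ :- c) :* x :+ y) :+ c :* x := y) refl c (falling n (suc j)) (falling n j) ⟩
  falling n j ∎
  where
  open ≡-Reasoning
  open +-*-Solver
  c = fromℕ n
  shift-X⊖c : shift (X ⊖ const c) ≗ const 1ℚ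
  shift-X⊖c zero = refl
  shift-X⊖c (suc _) = refl

n<j⇒falling≡0 : ∀ {n j} → n < j → falling n j ≡ 0ℚ
n<j⇒falling≡0 {zero} {suc j} _ = refl
n<j⇒falling≡0 {suc n} {suc j} (s≤s n<j) = begin
  falling (suc n) (suc j)
    ≡⟨ solve 2 (λ x c → x := x :+ c :* con 0ℚ) refl (falling (suc n) (suc j)) (fromℕ n) ⟩
  falling (suc n) (suc j) ⊕ fromℕ n * 0ℚ
    ≡⟨ cong (λ x → falling (suc n) (suc j) ⊕ fromℕ n * x) (n<j⇒falling≡0 (ℕ.m<n⇒m<1+n n<j)) ⟨
  falling (suc n) (suc j) ⊕ fromℕ n * falling n (suc j)
    ≡⟨ falling-suc-suc n j ⟩
  falling n j
    ≡⟨ n<j⇒falling≡0 n<j ⟩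
  0ℚ ∎
  where
  open ≡-Reasoning
  open +-*-Solver

-- The pairing of falling factorials with power series.

-- ⟨(x)ₙ | g⟩
L : ℕ → Series → ℚ
L n g = ∑[ i ≤ n ] (falling n (toℕ i) * (fromℕ (toℕ i !) * g (toℕ i)))

L-cong : ∀ n {f g} → f ≗ g → L n f ≡ L n g
L-cong n p = sum-cong-≗ {suc n} λ i → cong (λ x → falling n (toℕ i) * (fromℕ (toℕ i !) * x)) (p (toℕ i))

-- The left-hand side is ⟨x (x)ₙ | g⟩, and ⟨xʲ⁺¹ | g⟩ = (j + 1)! gⱼ₊₁ = j! (g′)ⱼ = ⟨xʲ | g′⟩.
L-suc : ∀ n g → L (suc n) g ⊕ fromℕ n * L n g ≡ L n (∂ g)
L-suc n g = begin
  L (suc n) g ⊕ c * L n g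
    -- Since (x)ₙ has degree n, a zero term at n + 1 can be appended; both sums then run over the
    -- same indices.
    ≡⟨ cong (λ x → L (suc n) g ⊕ c * x) (∑-zero-last n (λ j → falling n j * w j)
         (trans (cong (_* w (suc n)) (n<j⇒falling≡0 (ℕ.n<1+n n))) (ℚ.*-zeroˡ (w (suc n))))) ⟨
  L (suc n) g ⊕ c * (falling n 0 * w 0 ⊕ s)
    ≡⟨ solve 6 (λ c F₀ F₀′ w₀ s s′ →
           (F₀′ :* w₀ :+ s′) :+ c :* (F₀ :* w₀ :+ s) := (F₀′ :+ c :* F₀) :* w₀ :+ (s′ :+ c :* s))
         refl c (falling n 0) (falling (suc n) 0) (w 0) s s′ ⟩
  (falling (suc n) 0 ⊕ c * falling n 0) * w 0 ⊕ (s′ ⊕ c * s)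
    ≡⟨ cong₂ _⊕_ (trans (cong (_* w 0) (falling-suc-zero n)) (ℚ.*-zeroˡ (w 0)))
         (trans (cong (s′ ⊕_) (*-distribˡ-sum {suc n} c (λ i → falling n (suc (toℕ i)) * w (suc (toℕ i)))))
           (sym (∑-distrib-+ {suc n} (λ i → falling (suc n) (suc (toℕ i)) * w (suc (toℕ i)))
             (λ i → c * (falling n (suc (toℕ i)) * w (suc (toℕ i))))))) ⟩
  0ℚ ⊕ ∑[ i ≤ n ] (falling (suc n) (suc (toℕ i)) * w (suc (toℕ i)) ⊕ c * (falling n (suc (toℕ i)) * w (suc (toℕ i))))
    ≡⟨ ℚ.+-identityˡ _ ⟩
  ∑[ i ≤ n ] (falling (suc n) (suc (toℕ i)) * w (suc (toℕ i)) ⊕ c * (falling n (suc (toℕ i)) * w (suc (toℕ i))))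
    ≡⟨ sum-cong-≗ {suc n} (λ i → term (toℕ i)) ⟩
  L n (∂ g) ∎
  where
  open ≡-Reasoning
  open +-*-Solver
  c = fromℕ n
  w : ℕ → ℚ
  w j = fromℕ (j !) * g j
  s = ∑[ i ≤ n ] (falling n (suc (toℕ i)) * w (suc (toℕ i)))
  s′ = ∑[ i ≤ n ] (falling (suc n) (suc (toℕ i)) * w (suc (toℕ i)))
  term : ∀ j → falling (suc n) (suc j) * w (suc j) ⊕ c * (falling n (suc j) * w (suc j)) ≡
    falling n j * (fromℕ (j !) * ∂ g j)
  term j = begin
    falling (suc n) (suc j) * w (suc j) ⊕ c * (falling n (suc j) * w (suc j))
      ≡⟨ solve 4 (λ a b c w → a :* w :+ c :* (b :* w) := (a :+ c :* b) :* w) refl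
           (falling (suc n) (suc j)) (falling n (suc j)) c (w (suc j)) ⟩
    (falling (suc n) (suc j) ⊕ c * falling n (suc j)) * w (suc j)
      ≡⟨ cong₂ (λ x y → x * (y * g (suc j))) (falling-suc-suc n j) (fromℕ-* (suc j) (j !)) ⟩
    falling n j * (fromℕ (suc j) * fromℕ (j !) * g (suc j))
      ≡⟨ solve 4 (λ a b c d → a :* (b :* c :* d) := a :* (c :* (b :* d))) refl
           (falling n j) (fromℕ (suc j)) (fromℕ (j !)) (g (suc j)) ⟩
    falling n j * (fromℕ (j !) * ∂ g j) ∎

-- The transfer formula.

-- With A = [tⁿ] eᵗ (g′ E + (n + 2) g E′) and B = [tⁿ] eᵗ g E this reads
-- A + B = (n + 1) ([tⁿ⁺¹] eᵗ g + B); it comes from (eᵗ g E)′ and E + t E′ = eᵗ = 1 + t E.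
coefficient-recurrence : ∀ n g →
  (exp ⊛ (∂ g ⊛ E ⊞ const (fromℕ (suc (suc n))) ⊛ (g ⊛ ∂ E))) n ⊕ (exp ⊛ (g ⊛ E)) n ≡
  fromℕ (suc n) * ((exp ⊛ g) (suc n) ⊕ (exp ⊛ (g ⊛ E)) n)
coefficient-recurrence n g = begin
  (exp ⊛ (∂ g ⊛ E ⊞ const (fromℕ (suc (suc n))) ⊛ (g ⊛ ∂ E)) ⊞ F) n
    ≡⟨ expanded n ⟩
  ∂ F n ⊕ (const c ⊛ G) n
    -- `∂ F n` is `c * F (suc n)` by computation; raising `G` to the same index by a factor t lets
    -- `c` be taken out.
    ≡⟨ cong (∂ F n ⊕_) (trans (const-⊛ c G n) (cong (c *_) (sym (X-⊛-suc G n)))) ⟩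
  c * F (suc n) ⊕ c * (X ⊛ G) (suc n)
    ≡⟨ ℚ.*-distribˡ-+ c (F (suc n)) ((X ⊛ G) (suc n)) ⟨
  c * (F ⊞ X ⊛ G) (suc n)
    ≡⟨ cong (c *_) (reduced (suc n)) ⟩
  c * ((exp ⊛ g) (suc n) ⊕ (X ⊛ F) (suc n))
    ≡⟨ cong (λ x → c * ((exp ⊛ g) (suc n) ⊕ x)) (X-⊛-suc F n) ⟩
  c * ((exp ⊛ g) (suc n) ⊕ F n) ∎
  where
  open ≡-Reasoning
  module ≗ = SetoidReasoning seriesSetoid
  c = fromℕ (suc n)
  F G : Series
  F = exp ⊛ (g ⊛ E)
  G = exp ⊛ (g ⊛ ∂ E)
  expanded : exp ⊛ (∂ g ⊛ E ⊞ const (fromℕ (suc (suc n))) ⊛ (g ⊛ ∂ E)) ⊞ F ≗ ∂ F ⊞ const c ⊛ G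
  expanded = ≗.begin
    exp ⊛ (∂ g ⊛ E ⊞ const (fromℕ (suc (suc n))) ⊛ (g ⊛ ∂ E)) ⊞ F
      ≗.≈⟨ ⊞-congʳ F (⊛-congˡ exp (⊞-congˡ (∂ g ⊛ E) (⊛-congʳ (g ⊛ ∂ E) (const-suc (suc n))))) ⟩
    exp ⊛ (∂ g ⊛ E ⊞ (const 1ℚ ⊞ const c) ⊛ (g ⊛ ∂ E)) ⊞ F
      -- Of the n + 2 copies of g E′, one completes (g E)′ and n + 1 go into `G`; the added `F`
      -- plays the part of (eᵗ)′ g E.
      ≗.≈⟨ derivative-step exp g (∂ g) E (∂ E) (const c) ⟩
    (exp ⊛ (g ⊛ E) ⊞ exp ⊛ (∂ g ⊛ E ⊞ g ⊛ ∂ E)) ⊞ const c ⊛ G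
      ≗.≈⟨ ⊞-congʳ (const c ⊛ G) (⊞-cong (⊛-congʳ (g ⊛ E) ∂-exp) (⊛-congˡ exp (∂-⊛ g E))) ⟨
    (∂ exp ⊛ (g ⊛ E) ⊞ exp ⊛ ∂ (g ⊛ E)) ⊞ const c ⊛ G
      ≗.≈⟨ ⊞-congʳ (const c ⊛ G) (∂-⊛ exp (g ⊛ E)) ⟨
    ∂ F ⊞ const c ⊛ G ≗.∎
  reduced : F ⊞ X ⊛ G ≗ exp ⊛ g ⊞ X ⊛ F
  reduced = ≗.begin
    F ⊞ X ⊛ G                        ≗.≈⟨ factor-left exp g E X (∂ E) ⟩
    (exp ⊛ g) ⊛ (E ⊞ X ⊛ ∂ E)        ≗.≈⟨ ⊛-congˡ (exp ⊛ g) E⊞X⊛∂E≗exp ⟩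
    (exp ⊛ g) ⊛ exp                  ≗.≈⟨ ⊛-congˡ (exp ⊛ g) 1⊞X⊛E≗exp ⟨
    (exp ⊛ g) ⊛ (const 1ℚ ⊞ X ⊛ E)   ≗.≈⟨ expand-right exp g X E ⟩
    exp ⊛ g ⊞ X ⊛ F                  ≗.∎

-- Induction on n for all g at once, since the step uses the hypothesis at two other series. With H
-- = g Eⁿ⁺², both H and H′ have the factor Eⁿ⁺¹, with cofactors g E and g′ E + (n + 2) g E′.
L-⊛-E^ : ∀ n g → L n (g ⊛ E ^ˢ suc n) ≡ fromℕ (n !) * (exp ⊛ g) n
-- Only constant coefficients enter, and that of `E` is 1.
L-⊛-E^ zero g = solve 1
  (λ x → con 1ℚ :* (con 1ℚ :* (x :* (con 1ℚ :* con 1ℚ :+ con 0ℚ) :+ con 0ℚ)) :+ con 0ℚ :=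
    con 1ℚ :* (con 1ℚ :* x :+ con 0ℚ))
  refl (g 0)
  where open +-*-Solver
-- Adding (n + 1) n! b to both sides supplies the n ⟨(x)ₙ | H⟩ that `L-suc` asks for and the one
-- further n! b that `coefficient-recurrence` asks for.
L-⊛-E^ (suc n) g = Group.∙-cancelʳ ℚ.+-0-group (fromℕ (suc n) * (N * b)) _ _ (begin
  L (suc n) H ⊕ fromℕ (suc n) * (N * b)
    ≡⟨ cong (λ k → L (suc n) H ⊕ k * (N * b)) (fromℕ-suc n) ⟩
  L (suc n) H ⊕ (1ℚ ⊕ fromℕ n) * (N * b)
    ≡⟨ solve 4 (λ l c N b → l :+ (con 1ℚ :+ c) :* (N :* b) := (l :+ c :* (N :* b)) :+ N :* b) refl
         (L (suc n) H) (fromℕ n) N b ⟩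
  (L (suc n) H ⊕ fromℕ n * (N * b)) ⊕ N * b
    ≡⟨ cong (λ x → (L (suc n) H ⊕ fromℕ n * x) ⊕ N * b)
         (trans (L-cong n (λ k → sym (⊛-assoc g E P k))) (L-⊛-E^ n (g ⊛ E))) ⟨
  (L (suc n) H ⊕ fromℕ n * L n H) ⊕ N * b
    ≡⟨ cong (_⊕ N * b) (trans (L-suc n H) (trans (L-cong n ∂H) (L-⊛-E^ n (∂ g ⊛ E ⊞ c₂ ⊛ (g ⊛ ∂ E))))) ⟩
  N * a ⊕ N * b
    ≡⟨ ℚ.*-distribˡ-+ N a b ⟨
  N * (a ⊕ b)
    ≡⟨ cong (N *_) (coefficient-recurrence n g) ⟩
  N * (fromℕ (suc n) * ((exp ⊛ g) (suc n) ⊕ b))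
    ≡⟨ solve 4 (λ N c x b → N :* (c :* (x :+ b)) := (c :* N) :* x :+ c :* (N :* b)) refl
         N (fromℕ (suc n)) ((exp ⊛ g) (suc n)) b ⟩
  fromℕ (suc n) * N * (exp ⊛ g) (suc n) ⊕ fromℕ (suc n) * (N * b)
    ≡⟨ cong (λ x → x * (exp ⊛ g) (suc n) ⊕ fromℕ (suc n) * (N * b)) (fromℕ-* (suc n) (n !)) ⟨
  fromℕ (suc n !) * (exp ⊛ g) (suc n) ⊕ fromℕ (suc n) * (N * b) ∎)
  where
  open ≡-Reasoning
  open +-*-Solver
  P H c₂ : Series
  P = E ^ˢ suc n
  H = g ⊛ (E ⊛ P)
  c₂ = const (fromℕ (suc (suc n)))
  N = fromℕ (n !)
  a = (exp ⊛ (∂ g ⊛ E ⊞ c₂ ⊛ (g ⊛ ∂ E))) n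
  b = (exp ⊛ (g ⊛ E)) n
  ∂H : ∂ H ≗ (∂ g ⊛ E ⊞ c₂ ⊛ (g ⊛ ∂ E)) ⊛ P
  ∂H k = trans (∂-⊛ g (E ⊛ P) k)
    (trans (cong ((∂ g ⊛ (E ⊛ P)) k ⊕_) (⊛-congˡ g (∂-^ E (suc n)) k))
      (regroup g (∂ g) E (∂ E) P c₂ k))

-- Stirling numbers and binomial coefficients in terms of E and eᵗ.

-- Because (eᵗ - 1)ᵏ = tᵏ Eᵏ, its coefficient at l + k is that of Eᵏ at l.
S₂-[l+k]-k : ∀ l k → S₂ (l + k) k ≡ (+ ((l + k) !) / k !) {{k !≢0}} * (E ^ˢ k) l
S₂-[l+k]-k l k = cong ((+ ((l + k) !) / k !) {{k !≢0}} *_) (begin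
  ((exp ⊖ const 1ℚ) ^ˢ k) (l + k)  ≡⟨ ^-cong k exp⊖1≗X⊛E (l + k) ⟩
  ((X ⊛ E) ^ˢ k) (l + k)           ≡⟨ ^-distrib-⊛ X E k (l + k) ⟩
  (X ^ˢ k ⊛ E ^ˢ k) (l + k)        ≡⟨ X^-⊛-+ k (E ^ˢ k) l ⟩
  (E ^ˢ k) l                       ∎)
  where open ≡-Reasoning

-- Both binomials contain 1 / l!, so their quotient times (l + k)! / k! is (l + m)! / m!. The
-- variable `N` admits the bracketing (l + n) + 1 together with its own proof that the denominator
-- is nonzero.
C/C*S₂ : ∀ m l k {N} .{{_ : NonZero (N C l)}} → N ≡ l + k →
  (+ ((l + m) C l) / (N C l)) * S₂ N k ≡ (+ 1 / m !) {{m !≢0}} * (fromℕ ((l + m) !) * (E ^ˢ k) l)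
C/C*S₂ m l k refl = begin
  + C₁ / C₂ * S₂ (l + k) k
    ≡⟨ cong (+ C₁ / C₂ *_) (S₂-[l+k]-k l k) ⟩
  + C₁ / C₂ * (+ ((l + k) !) / k ! * e)
    ≡⟨ ℚ.*-assoc (+ C₁ / C₂) (+ ((l + k) !) / k !) e ⟨
  + C₁ / C₂ * (+ ((l + k) !) / k !) * e
    ≡⟨ cong (_* e) (/-*-/ C₁ C₂ ((l + k) !) (k !) ((l + m) !) (m !) factorials) ⟩
  + ((l + m) !) / m ! * e
    ≡⟨ cong (_* e) (/-*-/ 1 (m !) ((l + m) !) 1 ((l + m) !) (m !)
         (ℕSolver.solve 2 (λ a b → con 1 :* a :* b := a :* (b :* con 1)) refl ((l + m) !) (m !))) ⟨
  + 1 / m ! * fromℕ ((l + m) !) * e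
    ≡⟨ ℚ.*-assoc (+ 1 / m !) (fromℕ ((l + m) !)) e ⟩
  + 1 / m ! * (fromℕ ((l + m) !) * e) ∎
  where
  open ≡-Reasoning
  module ℕSolver = ℕ.+-*-Solver
  open ℕSolver using (con; _:*_; _:=_)
  instance
    m!≢0 = m !≢0
    k!≢0 = k !≢0
  C₁ = (l + m) C l
  C₂ = (l + k) C l
  e = (E ^ˢ k) l
  factorials : C₁ ℕ.* (l + k) ! ℕ.* m ! ≡ (l + m) ! ℕ.* (C₂ ℕ.* k !)
  factorials = begin
    C₁ ℕ.* (l + k) ! ℕ.* m !
      ≡⟨ cong (λ x → C₁ ℕ.* x ℕ.* m !) ([l+k]Cl*l!k!≡[l+k]! l k) ⟨
    C₁ ℕ.* (C₂ ℕ.* (l ! ℕ.* k !)) ℕ.* m !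
      ≡⟨ ℕSolver.solve 5 (λ a b c d e → a :* (b :* (c :* d)) :* e := a :* (c :* e) :* (b :* d)) refl
           C₁ C₂ (l !) (k !) (m !) ⟩
    C₁ ℕ.* (l ! ℕ.* m !) ℕ.* (C₂ ℕ.* k !)
      ≡⟨ cong (ℕ._* (C₂ ℕ.* k !)) ([l+k]Cl*l!k!≡[l+k]! l m) ⟩
    (l + m) ! ℕ.* (C₂ ℕ.* k !) ∎

-- Reads 1 / (n - m)! in n! / (m! (n - m)!) as a coefficient of eᵗ, the shape that the transfer
-- formula produces for g = tᵐ.
fromℕ-C : ∀ {m n} → m ≤ n → fromℕ (n C m) ≡ (+ 1 / m !) {{m !≢0}} * (fromℕ (n !) * exp (n ∸ m))
fromℕ-C {m} {n} m≤n = sym (begin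
  + 1 / m ! * (fromℕ (n !) * exp (n ∸ m))
    ≡⟨ cong (+ 1 / m ! *_) (/-*-/ (n !) 1 1 ((n ∸ m) !) (n !) ((n ∸ m) !)
         (solve 2 (λ a b → a :* con 1 :* b := a :* (con 1 :* b)) refl (n !) ((n ∸ m) !))) ⟩
  + 1 / m ! * (+ (n !) / (n ∸ m) !)
    ≡⟨ /-*-/ 1 (m !) (n !) ((n ∸ m) !) (n C m) 1
         (trans (solve 1 (λ a → con 1 :* a :* con 1 := a) refl (n !)) (sym (nCk*k![n∸k]!≡n! m≤n))) ⟩
  fromℕ (n C m) ∎)
  where
  open ≡-Reasoning
  open ℕ.+-*-Solver
  instance
    m!≢0 = m !≢0
    n∸m!≢0 = (n ∸ m) !≢0

theorem1 : (m n : ℕ) → m ≤ n →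
    fromℕ (n C m) ≡
    ∑[ i ≤ n ∸ m ]
    (let l = toℕ i in
    _/_ (+ ((l + m) C l)) ((l + n + 1) C l) {{nCk≢0 (l≤l+n+1 l n)}}
    * S₂ (l + n + 1) (n + 1)
    * S₁ n (l + m))
theorem1 m n m≤n = begin
  fromℕ (n C m)
    ≡⟨ fromℕ-C m≤n ⟩
  1/m! * (fromℕ (n !) * exp (n ∸ m))
    ≡⟨ cong (λ x → 1/m! * (fromℕ (n !) * x)) (begin
         (exp ⊛ X ^ˢ m) n              ≡⟨ ⊛-comm exp (X ^ˢ m) n ⟩
         (X ^ˢ m ⊛ exp) n              ≡⟨ cong (X ^ˢ m ⊛ exp) (ℕ.m∸n+n≡m m≤n) ⟨
         (X ^ˢ m ⊛ exp) (n ∸ m + m)    ≡⟨ X^-⊛-+ m exp (n ∸ m) ⟩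
         exp (n ∸ m)                   ∎) ⟨
  1/m! * (fromℕ (n !) * (exp ⊛ X ^ˢ m) n)
    ≡⟨ cong (1/m! *_) (L-⊛-E^ n (X ^ˢ m)) ⟨
  1/m! * L n Y
    -- The factor tᵐ of `Y` kills the terms with j < m; the others are indexed by l = j - m.
    ≡⟨ cong (1/m! *_) (∑-zero-init m≤n (λ j → falling n j * (fromℕ (j !) * Y j)) vanishing) ⟩
  1/m! * ∑[ i ≤ n ∸ m ] (falling n (toℕ i + m) * (fromℕ ((toℕ i + m) !) * Y (toℕ i + m)))
    ≡⟨ *-distribˡ-sum {suc (n ∸ m)} 1/m!
         (λ i → falling n (toℕ i + m) * (fromℕ ((toℕ i + m) !) * Y (toℕ i + m))) ⟩
  ∑[ i ≤ n ∸ m ] (1/m! * (falling n (toℕ i + m) * (fromℕ ((toℕ i + m) !) * Y (toℕ i + m))))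
    ≡⟨ sum-cong-≗ {suc (n ∸ m)} (λ i → term (toℕ i)) ⟩
  ∑[ i ≤ n ∸ m ] summand (toℕ i) ∎
  where
  open ≡-Reasoning
  open +-*-Solver
  1/m! : ℚ
  1/m! = (+ 1 / m !) {{m !≢0}}
  Y : Series
  Y = X ^ˢ m ⊛ E ^ˢ suc n
  summand : ℕ → ℚ
  summand l = _/_ (+ ((l + m) C l)) ((l + n + 1) C l) {{nCk≢0 (l≤l+n+1 l n)}}
    * S₂ (l + n + 1) (n + 1) * S₁ n (l + m)
  vanishing : ∀ {j} → j < m → falling n j * (fromℕ (j !) * Y j) ≡ 0ℚ
  vanishing {j} j<m = trans (cong (λ y → falling n j * (fromℕ (j !) * y)) (X^-⊛-< (E ^ˢ suc n) j<m))
    (solve 2 (λ a b → a :* (b :* con 0ℚ) := con 0ℚ) refl (falling n j) (fromℕ (j !)))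
  term : ∀ l → 1/m! * (falling n (l + m) * (fromℕ ((l + m) !) * Y (l + m))) ≡ summand l
  term l = begin
    1/m! * (falling n (l + m) * (fromℕ ((l + m) !) * Y (l + m)))
      -- The factor tᵐ is stripped from `Y`, and the exponent `suc n` is rewritten as `n + 1` to
      -- match the theorem.
      ≡⟨ cong (λ y → 1/m! * (falling n (l + m) * (fromℕ ((l + m) !) * y)))
           (trans (X^-⊛-+ m (E ^ˢ suc n) l) (cong (λ k → (E ^ˢ k) l) (ℕ.+-comm 1 n))) ⟩
    1/m! * (falling n (l + m) * (fromℕ ((l + m) !) * (E ^ˢ (n + 1)) l))
      ≡⟨ solve 4 (λ a b c d → a :* (b :* (c :* d)) := (a :* (c :* d)) :* b) refl
           1/m! (falling n (l + m)) (fromℕ ((l + m) !)) ((E ^ˢ (n + 1)) l) ⟩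
    1/m! * (fromℕ ((l + m) !) * (E ^ˢ (n + 1)) l) * falling n (l + m)
      ≡⟨ cong (_* falling n (l + m))
           (C/C*S₂ m l (n + 1) {{nCk≢0 (l≤l+n+1 l n)}} (ℕ.+-assoc l n 1)) ⟨
    summand l ∎
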